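{- Let $m,n\geq 4$ be integers with $m\neq 5$ and $n\neq 5$. Then $s_6(C_m\square C_n)=4$.
   Context: $P_k$ denotes the path on $k$ vertices, $C_k$ the cycle on $k$ vertices, and $\square$ denotes the Cartesian product of graphs. A $P_k$-coloring of a graph $G$ is a proper vertex coloring of $G$ in which no copy of $P_k$ in $G$ (as a subgraph, not necessarily induced) is bicolored, i.e. has its vertices colored using only two colors. The $P_k$-chromatic number $s_k(G)$ is the minimum number of colors in a $P_k$-coloring of $G$. -}

module Defs where

open import Data.Fin using (Fin; toℕ)
open import Data.Nat using (ℕ; suc; _≤_; s≤s)
open import Data.Nat.Properties using (1+n≢n)
open import Data.Product using (_×_; _,_; ∃-syntax)
open import Data.Sum using (_⊎_; inj₁; inj₂; swap; [_,_]′)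
open import Function.Definitions using (Injective)
open import Level using (0ℓ)
open import Relation.Binary.Core using (Rel; _=[_]⇒_)
open import Relation.Binary.Definitions using (Symmetric; Irreflexive)
open import Relation.Binary.PropositionalEquality using (_≡_; _≢_; refl; sym; trans; cong)
open import Relation.Nullary using (¬_)

record Graph : Set₁ where
  field
    Vertex : Set
    Adj    : Rel Vertex 0ℓ
    symm   : Symmetric Adj
    irrefl : Irreflexive _≡_ Adj

open Graph

data PathNext {k : ℕ} (i j : Fin k) : Set where
  step : suc (toℕ i) ≡ toℕ j → PathNext i j

data CycleNext {k : ℕ} (i j : Fin k) : Set where
  step : suc (toℕ i) ≡ toℕ j → CycleNext i j
  wrap : suc (toℕ i) ≡ k → toℕ j ≡ 0 → CycleNext i j

path : ℕ → Graph
path k = record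
  { Vertex = Fin k
  ; Adj    = λ i j → PathNext i j ⊎ PathNext j i
  ; symm   = swap
  ; irrefl = λ { refl → [ loopless , loopless ]′ }
  }
  where
  loopless : {i : Fin k} → ¬ PathNext i i
  loopless (step e) = 1+n≢n e

-- For k ≤ 2 the definition below would give a loop or a single edge.
cycle : (k : ℕ) → 3 ≤ k → Graph
cycle k 3≤k = record
  { Vertex = Fin k
  ; Adj    = λ i j → CycleNext i j ⊎ CycleNext j i
  ; symm   = swap
  ; irrefl = λ { refl → [ loopless , loopless ]′ }
  }
  where
  k≢1 : ∀ {l} → 3 ≤ l → 1 ≢ l
  k≢1 (s≤s ()) refl

  loopless : {i : Fin k} → ¬ CycleNext i i
  loopless (step e)   = 1+n≢n e
  loopless (wrap e z) = k≢1 3≤k (trans (cong suc (sym z)) e)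

infixr 7 _□_

_□_ : Graph → Graph → Graph
G □ H = record
  { Vertex = Vertex G × Vertex H
  ; Adj    = adj
  ; symm   = λ { (inj₁ (e , a)) → inj₁ (sym e , symm H a)
               ; (inj₂ (a , e)) → inj₂ (symm G a , sym e) }
  ; irrefl = λ { refl (inj₁ (_ , a)) → irrefl H refl a
               ; refl (inj₂ (a , _)) → irrefl G refl a }
  }
  where
  adj : Rel (Vertex G × Vertex H) 0ℓ
  adj (u , v) (u′ , v′) = (u ≡ u′ × Adj H v v′) ⊎ (Adj G u u′ × v ≡ v′)

-- A copy of H in G as a not necessarily induced subgraph.
record Copy (H G : Graph) : Set where
  field
    embed     : Vertex H → Vertex G
    injective : Injective _≡_ _≡_ embed
    preserves : Adj H =[ embed ]⇒ Adj G

open Copy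

Coloring : Graph → ℕ → Set
Coloring G c = Vertex G → Fin c

Proper : (G : Graph) {c : ℕ} → Coloring G c → Set
Proper G f = ∀ {u v} → Adj G u v → f u ≢ f v

Bicolored : {H G : Graph} {c : ℕ} → Coloring G c → Copy H G → Set
Bicolored f φ = ∃[ a ] ∃[ b ] (∀ i → f (embed φ i) ≡ a ⊎ f (embed φ i) ≡ b)

IsPathColoring : ℕ → (G : Graph) {c : ℕ} → Coloring G c → Set
IsPathColoring k G f = Proper G f × ((φ : Copy (path k) G) → ¬ Bicolored f φ)

PathColorable : ℕ → Graph → ℕ → Set
PathColorable k G c = ∃[ f ] IsPathColoring k G {c} f

IsLeast : (ℕ → Set) → ℕ → Set
IsLeast P s = P s × (∀ c → P c → s ≤ c)

-- HasPathChromaticNumber k G s is the equation s_k(G) = s, stated as a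
-- relation because a minimum over ℕ of an arbitrary predicate is not
-- computable.
HasPathChromaticNumber : ℕ → Graph → ℕ → Set
HasPathChromaticNumber k G = IsLeast (PathColorable k G)

{-# OPTIONS --safe #-}
-- Upper bound: colour (u , v) by x u ⊕ y v, where ⊕ is the Klein four-group on
-- the colours and x, y are colourings of the two cycles in which vertices at
-- distance at most 2 differ; on a cycle of length 3a + 4b such a colouring is
-- the word (012)ᵃ(0123)ᵇ. A bicolored path cannot make two consecutive steps in
-- the same factor, and four steps alternating between the factors close up to a
-- 4-cycle, so bicolored paths have at most four vertices.
--
-- Lower bound: the torus contains the 4 × 4 grid, and a search shows that
-- every proper 3-coloring of that grid has a bicolored path on six vertices.
module Submission where

open import Defs
open import Data.Empty using (⊥)
open import Data.Fin using (Fin; zero; suc; toℕ; inject₁; inject≤; punchIn; punchOut)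
open import Data.Fin.Patterns using (0F; 1F; 2F; 3F; 4F; 5F)
open import Data.Fin.Properties
  using (_≟_; all?; any?; toℕ-injective; toℕ-inject₁; toℕ-inject≤; toℕ<n; inject≤-injective;
         suc-injective; punchIn-punchOut)
open import Data.List using (List; []; _∷_; map)
open import Data.List.Relation.Unary.All using (All; []; _∷_)
open import Data.List.Relation.Unary.Any as Any using (Any; here; there)
open import Data.Nat using (ℕ; zero; suc; _+_; _*_; _≤_; s≤s; s≤s⁻¹; _≤′_; ≤′-refl; ≤′-step)
import Data.Nat as ℕ
open import Data.Nat.DivMod using (_/_; _mod_)
open import Data.Nat.Properties using (<⇒≤; ≤⇒≤′; ≮⇒≥; +-comm; +-identityʳ)
import Data.Nat.Properties as ℕ
open import Data.Product using (_×_; _,_; proj₁; proj₂; ∃-syntax)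
import Data.Product as Product
open import Data.Product.Properties using (≡-dec)
open import Data.Sum using (_⊎_; inj₁; inj₂; [_,_]′)
import Data.Sum as Sum
open import Data.Vec as Vec using (Vec; []; _∷_; lookup)
import Data.Vec.Relation.Unary.All as VecAll
import Data.Vec.Relation.Unary.All.Properties as VecAll
open import Function using (_∘_)
open import Relation.Binary.Definitions using (Decidable; DecidableEquality)
open import Relation.Binary.PropositionalEquality
  using (_≡_; _≢_; refl; sym; trans; cong; cong₂; subst)
open import Relation.Nullary using (¬_; Dec; no; contradiction)
open import Relation.Nullary.Decidable
  using (map′; _×-dec_; _⊎-dec_; _→-dec_; ¬?; from-yes)

open Graph
open Copy

-- Copies of graphs and monotonicity of path colorability.

_∘ᶜ_ : ∀ {F G H} → Copy G H → Copy F G → Copy F H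
ψ ∘ᶜ φ = record
  { embed     = embed ψ ∘ embed φ
  ; injective = injective φ ∘ injective ψ
  ; preserves = preserves ψ ∘ preserves φ
  }

□-copy : ∀ {G G′ H H′} → Copy G G′ → Copy H H′ → Copy (G □ H) (G′ □ H′)
□-copy φ ψ = record
  { embed     = λ (u , v) → embed φ u , embed ψ v
  ; injective = λ e → cong₂ _,_ (injective φ (cong proj₁ e)) (injective ψ (cong proj₂ e))
  ; preserves = Sum.map (Product.map (cong (embed φ)) (preserves ψ))
                        (Product.map (preserves φ) (cong (embed ψ)))
  }

path⊆cycle : ∀ {k m} (3≤m : 3 ≤ m) → k ≤ m → Copy (path k) (cycle m 3≤m)
path⊆cycle {k} {m} 3≤m k≤m = record
  { embed     = λ i → inject≤ i k≤m
  ; injective = inject≤-injective k≤m k≤m _ _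
  ; preserves = Sum.map next next
  }
  where
  next : ∀ {i j : Fin k} → PathNext i j → CycleNext (inject≤ i k≤m) (inject≤ j k≤m)
  next {i} {j} (step e) =
    step (trans (cong suc (toℕ-inject≤ i k≤m)) (trans e (sym (toℕ-inject≤ j k≤m))))

colorable-restrict : ∀ {k c G H} → Copy H G → PathColorable k G c → PathColorable k H c
colorable-restrict φ (f , proper , no-bicolored) =
  f ∘ embed φ , proper ∘ preserves φ , λ ψ → no-bicolored (φ ∘ᶜ ψ)

colorable-suc : ∀ {k c G} → PathColorable (suc k) G c → PathColorable (suc k) G (suc c)
colorable-suc {G = G} (f , proper , no-bicolored) =
  suc ∘ f , (λ a e → proper a (suc-injective e)) , bicolored
  where
  bicolored : (φ : Copy (path _) G) → ¬ Bicolored {G = G} (suc ∘ f) φ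
  bicolored φ (a , b , ab) =
    no-bicolored φ (pred a , pred b , λ i → Sum.map (cong pred) (cong pred) (ab i))
    where
    pred : Fin (suc _) → Fin _
    -- Color `zero` does not occur in `suc ∘ f`, so any default is sound; the first vertex of the
    -- path supplies one, as `Fin c` alone might be empty.
    pred zero    = f (embed φ zero)
    pred (suc i) = i

colorable-mono : ∀ {k c d G} → c ≤′ d → PathColorable (suc k) G c → PathColorable (suc k) G d
colorable-mono ≤′-refl       p = p
colorable-mono (≤′-step c≤d) p = colorable-suc (colorable-mono c≤d p)

-- Refutation of 3-colorability by search

module Search (G : Graph) (_≟ᵛ_ : DecidableEquality (Vertex G)) (adj? : Decidable (Adj G)) where

  Assignment : Set
  Assignment = List (Vertex G × Fin 3)

  IsPath : ∀ {k} → Vec (Vertex G) (suc k) → Set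
  IsPath {k} p = (∀ (i : Fin k) → Adj G (lookup p (inject₁ i)) (lookup p (suc i)))
               × (∀ i j → lookup p i ≡ lookup p j → i ≡ j)

  isPath? : ∀ {k} (p : Vec (Vertex G) (suc k)) → Dec (IsPath p)
  isPath? p = all? (λ i → adj? (lookup p (inject₁ i)) (lookup p (suc i)))
    ×-dec all? (λ i → all? (λ j → (lookup p i ≟ᵛ lookup p j) →-dec (i ≟ j)))

  path-copy : ∀ {k} (p : Vec (Vertex G) (suc k)) → IsPath p → Copy (path (suc k)) G
  path-copy {k} p (adjacent , distinct) = record
    { embed     = lookup p
    ; injective = distinct _ _
    ; preserves = [ next , symm G ∘ next ]′
    }
    where
    next : ∀ {i j} → PathNext i j → Adj G (lookup p i) (lookup p j)
    next {i} {suc j} (step e) =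
      subst (λ i → Adj G (lookup p i) (lookup p (suc j)))
            (sym (toℕ-injective (trans (ℕ.suc-injective e) (sym (toℕ-inject₁ j)))))
            (adjacent j)

  Clash : Vertex G → Fin 3 → Assignment → Set
  Clash v c = Any (λ (u , d) → c ≡ d × Adj G v u)

  -- With three colors, bicolored means that some color `e` is missing. Membership in `ρ` also
  -- ensures that every vertex is already assigned.
  Avoids : ∀ {k} → Fin 3 → Assignment → Vec (Vertex G) k → Set
  Avoids e ρ = VecAll.All (λ v → Any (λ (u , d) → v ≡ u × e ≢ d) ρ)

  BicoloredPath : ∀ {k} → Assignment → List (Vec (Vertex G) (suc k)) → Set
  BicoloredPath ρ ps = Any (λ p → (∃[ e ] Avoids e ρ p) × IsPath p) ps

  -- A plan lists the vertices in the order in which they are assigned, each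
  -- with the paths to be tested once it has received its color.
  Plan : ℕ → Set
  Plan k = List (Vertex G × List (Vec (Vertex G) (suc k)))

  -- The end of a plan is a partial coloring that survived all tests, hence `⊥`: the proposition
  -- says that every branch of the search tree closes earlier.
  Refuted : ∀ {k} → Assignment → Plan k → Set
  Refuted ρ []                = ⊥
  Refuted ρ ((v , ps) ∷ plan) = ∀ c →
    Clash v c ρ ⊎ BicoloredPath ((v , c) ∷ ρ) ps ⊎ Refuted ((v , c) ∷ ρ) plan

  refuted? : ∀ {k} ρ (plan : Plan k) → Dec (Refuted ρ plan)
  refuted? ρ []                = no λ ()
  refuted? ρ ((v , ps) ∷ plan) = all? λ c →
    Any.any? (λ (u , d) → (c ≟ d) ×-dec adj? v u) ρ
    ⊎-dec Any.any? (λ p → any? (λ e → avoids? e ((v , c) ∷ ρ) p) ×-dec isPath? p) ps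
    ⊎-dec refuted? ((v , c) ∷ ρ) plan
    where
    avoids? : ∀ {k} e ρ (p : Vec (Vertex G) k) → Dec (Avoids e ρ p)
    avoids? e ρ = VecAll.all? λ v → Any.any? (λ (u , d) → (v ≟ᵛ u) ×-dec ¬? (e ≟ d)) ρ

  -- A coloring `f` singles out the branch that gives each `v` the color `f v`. On it a clash
  -- contradicts properness, and a path found contradicts `no-bicolored`.
  refutation-sound : ∀ {k} (plan : Plan k) → Refuted [] plan → ¬ PathColorable (suc k) G 3
  refutation-sound {k} plan refuted (f , proper , no-bicolored) = go plan [] refuted
    where
    Agrees : Assignment → Set
    Agrees = All (λ (v , c) → f v ≡ c)

    no-clash : ∀ {ρ v} → Agrees ρ → ¬ Clash v (f v) ρ
    no-clash (fu≡d ∷ _) (here (c≡d , a)) = proper a (trans c≡d (sym fu≡d))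
    no-clash (_ ∷ agrees) (there clash)  = no-clash agrees clash

    color-≢ : ∀ {ρ v e} → Agrees ρ → Any (λ (u , d) → v ≡ u × e ≢ d) ρ → e ≢ f v
    color-≢ (fu≡d ∷ _)   (here (refl , e≢d)) e≡fu = e≢d (trans e≡fu fu≡d)
    color-≢ (_ ∷ agrees) (there assigned)         = color-≢ agrees assigned

    two-left : ∀ (i : Fin 2) (e : Fin 3) → punchIn e i ≡ punchIn e 0F ⊎ punchIn e i ≡ punchIn e 1F
    two-left 0F e = inj₁ refl
    two-left 1F e = inj₂ refl

    bicolored : ∀ {ρ e} (p : Vec (Vertex G) (suc k)) (isPath : IsPath p) →
                Agrees ρ → Avoids e ρ p → Bicolored {G = G} f (path-copy p isPath)
    -- `punchIn e` enumerates the two colors other than `e`.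
    bicolored {e = e} p _ agrees avoids = punchIn e 0F , punchIn e 1F , λ i →
      let e≢fi = color-≢ agrees (VecAll.lookup⁺ avoids i)
          same = punchIn-punchOut e≢fi
      in Sum.map (trans (sym same)) (trans (sym same)) (two-left (punchOut e≢fi) e)

    no-path : ∀ {ρ} (ps : List (Vec (Vertex G) (suc k))) → Agrees ρ → ¬ BicoloredPath ρ ps
    no-path (p ∷ ps) agrees (here ((e , avoids) , isPath)) =
      no-bicolored (path-copy p isPath) (bicolored p isPath agrees avoids)
    no-path (p ∷ ps) agrees (there found) = no-path ps agrees found

    go : ∀ {ρ} (plan : Plan k) → Agrees ρ → ¬ Refuted ρ plan
    go ((v , ps) ∷ plan) agrees refuted with refuted (f v)
    ... | inj₁ clash               = no-clash agrees clash
    ... | inj₂ (inj₁ found)        = no-path ps (refl ∷ agrees) found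
    ... | inj₂ (inj₂ refuted-rest) = go plan (refl ∷ agrees) refuted-rest

-- The 4 × 4 grid.

path-adj? : ∀ {k} → Decidable (Adj (path k))
path-adj? i j = next? i j ⊎-dec next? j i
  where
  next? : ∀ {k} (i j : Fin k) → Dec (PathNext i j)
  next? i j = map′ step (λ { (step e) → e }) (suc (toℕ i) ℕ.≟ toℕ j)

grid : Graph
grid = path 4 □ path 4

_≟ᵍ_ : DecidableEquality (Vertex grid)
_≟ᵍ_ = ≡-dec _≟_ _≟_

grid-adj? : Decidable (Adj grid)
grid-adj? (u , v) (u′ , v′) =
  ((u ≟ u′) ×-dec path-adj? v v′) ⊎-dec (path-adj? u u′ ×-dec (v ≟ v′))

open Search grid _≟ᵍ_ grid-adj?

-- The cells of the grid are numbered row by row. The order of the cells and the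
-- paths tested come from a computer search for a small refutation.
grid-plan : Plan 5
grid-plan = map (λ (v , ps) → cell v , map (Vec.map cell) ps)
  ( ( 9 , [])
  ∷ ( 8 , [])
  ∷ ( 4 , [])
  ∷ ( 5 , [])
  ∷ ( 6 , [])
  ∷ (10 , [])
  ∷ ( 0 , ( 0 ∷  4 ∷  5 ∷  9 ∷ 10 ∷  6 ∷ []) ∷ [])
  ∷ ( 1 , ( 1 ∷  0 ∷  4 ∷  5 ∷  6 ∷ 10 ∷ [])
         ∷ ( 0 ∷  1 ∷  5 ∷  9 ∷  8 ∷  4 ∷ []) ∷ [])
  ∷ ( 2 , ( 2 ∷  6 ∷ 10 ∷  9 ∷  8 ∷  4 ∷ [])
         ∷ ( 2 ∷  1 ∷  5 ∷  9 ∷  8 ∷  4 ∷ [])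
         ∷ ( 4 ∷  5 ∷  1 ∷  2 ∷  6 ∷ 10 ∷ [])
         ∷ ( 2 ∷  1 ∷  0 ∷  4 ∷  8 ∷  9 ∷ [])
         ∷ ( 0 ∷  1 ∷  2 ∷  6 ∷  5 ∷  9 ∷ []) ∷ [])
  ∷ ( 3 , ( 3 ∷  2 ∷  1 ∷  5 ∷  6 ∷ 10 ∷ [])
         ∷ ( 3 ∷  2 ∷  6 ∷  5 ∷  9 ∷  8 ∷ [])
         ∷ ( 3 ∷  2 ∷  1 ∷  5 ∷  9 ∷  8 ∷ [])
         ∷ ( 3 ∷  2 ∷  1 ∷  5 ∷  4 ∷  8 ∷ []) ∷ [])
  ∷ (11 , ( 8 ∷  9 ∷  5 ∷  6 ∷ 10 ∷ 11 ∷ [])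
         ∷ ( 0 ∷  4 ∷  5 ∷  9 ∷ 10 ∷ 11 ∷ []) ∷ [])
  ∷ ( 7 , ( 3 ∷  7 ∷  6 ∷ 10 ∷  9 ∷  8 ∷ [])
         ∷ ( 0 ∷  4 ∷  5 ∷  6 ∷  7 ∷ 11 ∷ [])
         ∷ ( 1 ∷  2 ∷  6 ∷ 10 ∷ 11 ∷  7 ∷ [])
         ∷ ( 5 ∷  6 ∷  2 ∷  3 ∷  7 ∷ 11 ∷ [])
         ∷ ( 7 ∷  3 ∷  2 ∷  1 ∷  5 ∷  9 ∷ [])
         ∷ ( 7 ∷  6 ∷  2 ∷  1 ∷  5 ∷  9 ∷ [])
         ∷ ( 3 ∷  7 ∷  6 ∷  5 ∷  4 ∷  8 ∷ [])
         ∷ ( 0 ∷  1 ∷  5 ∷  6 ∷  7 ∷  3 ∷ []) ∷ [])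
  ∷ (14 , ( 0 ∷  4 ∷  5 ∷  9 ∷ 10 ∷ 14 ∷ []) ∷ [])
  ∷ (13 , ( 3 ∷  2 ∷  6 ∷ 10 ∷ 14 ∷ 13 ∷ [])
         ∷ ( 1 ∷  5 ∷  9 ∷ 10 ∷ 14 ∷ 13 ∷ [])
         ∷ ( 1 ∷  2 ∷  6 ∷ 10 ∷  9 ∷ 13 ∷ [])
         ∷ ( 1 ∷  5 ∷  4 ∷  8 ∷  9 ∷ 13 ∷ [])
         ∷ ( 1 ∷  5 ∷  6 ∷ 10 ∷ 14 ∷ 13 ∷ [])
         ∷ ( 1 ∷  0 ∷  4 ∷  8 ∷  9 ∷ 13 ∷ []) ∷ [])
  ∷ (15 , ( 1 ∷  2 ∷  6 ∷ 10 ∷ 14 ∷ 15 ∷ [])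
         ∷ ( 4 ∷  5 ∷  6 ∷ 10 ∷ 11 ∷ 15 ∷ []) ∷ [])
  ∷ (12 , [])
  ∷ [])
  where
  cell : ℕ → Fin 4 × Fin 4
  cell i = (i / 4) mod 4 , i mod 4

-- The search is evaluated during type checking, with all three colors tried at each cell.
grid-not-3-colorable : ¬ PathColorable 6 grid 3
grid-not-3-colorable = refutation-sound grid-plan (from-yes (refuted? [] grid-plan))

-- Colorings in which vertices at distance at most 2 differ

SquareColoring : (G : Graph) {c : ℕ} → Coloring G c → Set
SquareColoring G x = Proper G x × (∀ {v u w} → Adj G v u → Adj G v w → x u ≡ x w → u ≡ w)

-- The word (012)ᵃ(0123)(0123)…
label : ℕ → ℕ → Fin 4
label zero    0                         = 0F
label zero    1                         = 1F
label zero    2                         = 2F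
label zero    3                         = 3F
label zero    (suc (suc (suc (suc i)))) = label zero i
label (suc a) 0                         = 0F
label (suc a) 1                         = 1F
label (suc a) 2                         = 2F
label (suc a) (suc (suc (suc i)))       = label a i

-- Both blocks 012 and 0123 begin with 01, so comparisons reaching across a block boundary do not
-- depend on which block follows.
label-0 : ∀ a → label a 0 ≡ 0F
label-0 zero    = refl
label-0 (suc a) = refl

label-1 : ∀ a → label a 1 ≡ 1F
label-1 zero    = refl
label-1 (suc a) = refl

label-≢₁ : ∀ a i → label a i ≢ label a (1 + i)
label-≢₁ zero    0 ()
label-≢₁ zero    1 ()
label-≢₁ zero    2 ()
label-≢₁ zero    3 ()
label-≢₁ zero    (suc (suc (suc (suc i)))) = label-≢₁ zero i
label-≢₁ (suc a) 0 ()
label-≢₁ (suc a) 1 ()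
label-≢₁ (suc a) 2 e with () ← trans e (label-0 a)
label-≢₁ (suc a) (suc (suc (suc i))) = label-≢₁ a i

label-≢₂ : ∀ a i → label a i ≢ label a (2 + i)
label-≢₂ zero    0 ()
label-≢₂ zero    1 ()
label-≢₂ zero    2 ()
label-≢₂ zero    3 ()
label-≢₂ zero    (suc (suc (suc (suc i)))) = label-≢₂ zero i
label-≢₂ (suc a) 0 ()
label-≢₂ (suc a) 1 e with () ← trans e (label-0 a)
label-≢₂ (suc a) 2 e with () ← trans e (label-1 a)
label-≢₂ (suc a) (suc (suc (suc i))) = label-≢₂ a i

-- Reading past a full turn of the cycle continues with 0123..., whose first two letters match those
-- at the start; this controls the wrap-around.
label-shift : ∀ a b i → label a (a * 3 + b * 4 + i) ≡ label zero i
label-shift zero    zero    i = refl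
label-shift zero    (suc b) i = label-shift zero b i
label-shift (suc a) b       i = label-shift a b i

-- Induction in steps of 3 from 6 = 3 + 3, 7 = 3 + 4 and 8 = 4 + 4.
3a+4b : ∀ k → ∃[ a ] ∃[ b ] 6 + k ≡ a * 3 + b * 4
3a+4b 0 = 2 , 0 , refl
3a+4b 1 = 1 , 1 , refl
3a+4b 2 = 0 , 2 , refl
3a+4b (suc (suc (suc k))) with a , b , e ← 3a+4b k = suc a , b , cong (3 +_) e

≢5⇒3a+4b : ∀ {m} → 3 ≤ m → m ≢ 5 → ∃[ a ] ∃[ b ] m ≡ a * 3 + b * 4
≢5⇒3a+4b {3} _ _   = 1 , 0 , refl
≢5⇒3a+4b {4} _ _   = 0 , 1 , refl
≢5⇒3a+4b {5} _ 5≢5 = contradiction refl 5≢5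
≢5⇒3a+4b {suc (suc (suc (suc (suc (suc k)))))} _ _ = 3a+4b k
≢5⇒3a+4b {1} (s≤s ())
≢5⇒3a+4b {2} (s≤s (s≤s ()))

cycleNext-injective : ∀ {m} {i j k : Fin m} → CycleNext i k → CycleNext j k → i ≡ j
cycleNext-injective (step e)   (step e′)   = toℕ-injective (ℕ.suc-injective (trans e (sym e′)))
cycleNext-injective (step e)   (wrap _ z)  with () ← trans e z
cycleNext-injective (wrap _ z) (step e)    with () ← trans e z
cycleNext-injective (wrap e _) (wrap e′ _) = toℕ-injective (ℕ.suc-injective (trans e (sym e′)))

cycleNext-functional : ∀ {m} {i j k : Fin m} → CycleNext i j → CycleNext i k → j ≡ k
cycleNext-functional (step e)   (step e′)   = toℕ-injective (trans (sym e) e′)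
cycleNext-functional {j = j} (step e) (wrap e′ _) =
  contradiction (trans (sym e) e′) (ℕ.<⇒≢ (toℕ<n j))
cycleNext-functional {k = k} (wrap e _) (step e′) =
  contradiction (trans (sym e′) e) (ℕ.<⇒≢ (toℕ<n k))
cycleNext-functional (wrap _ z) (wrap _ z′) = toℕ-injective (trans z (sym z′))

cycle-squareColoring : ∀ {m} (3≤m : 3 ≤ m) → m ≢ 5 → ∃[ x ] SquareColoring (cycle m 3≤m) {4} x
cycle-squareColoring {m} 3≤m m≢5 with a , b , m≡3a+4b ← ≢5⇒3a+4b 3≤m m≢5 =
  x , [ next-≢ , (λ n → next-≢ n ∘ sym) ]′ , locally-injective
  where
  x : Fin m → Fin 4
  x i = label a (toℕ i)

  label-m+ : ∀ i → label a (m + i) ≡ label zero i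
  label-m+ i = trans (cong (λ m → label a (m + i)) m≡3a+4b) (label-shift a b i)

  label-m : label a m ≡ label a 0
  label-m = trans (cong (label a) (sym (+-identityʳ m))) (trans (label-m+ 0) (sym (label-0 a)))

  label-1+m : label a (1 + m) ≡ label a 1
  label-1+m = trans (cong (label a) (+-comm 1 m)) (trans (label-m+ 1) (sym (label-1 a)))

  -- Reading the word beyond position `m` lets a wrap be treated like an ordinary step.
  x-next : ∀ {i j : Fin m} → CycleNext i j → label a (1 + toℕ i) ≡ x j
  x-next (step e)   = cong (label a) e
  x-next (wrap e z) = trans (cong (label a) e) (trans label-m (cong (label a) (sym z)))

  x-next² : ∀ {i j k : Fin m} → CycleNext i j → CycleNext j k → label a (2 + toℕ i) ≡ x k
  x-next² (step e)   n           = trans (cong (label a ∘ suc) e) (x-next n)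
  x-next² (wrap e z) (step e′)   = trans (cong (label a ∘ suc) e)
    (trans label-1+m (cong (label a) (trans (cong suc (sym z)) e′)))
  -- Two wraps in a row would force `m` to be 1.
  x-next² (wrap e z) (wrap e′ _) =
    contradiction (subst (3 ≤_) (trans (sym e′) (cong suc z)) 3≤m) λ { (s≤s ()) }

  next-≢ : ∀ {i j : Fin m} → CycleNext i j → x i ≢ x j
  next-≢ {i} n e = label-≢₁ a (toℕ i) (trans e (sym (x-next n)))

  next²-≢ : ∀ {i j k : Fin m} → CycleNext i j → CycleNext j k → x i ≢ x k
  next²-≢ {i} n n′ e = label-≢₂ a (toℕ i) (trans e (sym (x-next² n n′)))

  -- Neighbors on the same side of `v` coincide; those on opposite sides are two steps apart along
  -- the cycle.
  locally-injective : ∀ {v u w} → Adj (cycle m 3≤m) v u → Adj (cycle m 3≤m) v w → x u ≡ x w → u ≡ w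
  locally-injective (inj₁ n) (inj₁ n′) _ = cycleNext-functional n n′
  locally-injective (inj₁ n) (inj₂ n′) e = contradiction (sym e) (next²-≢ n′ n)
  locally-injective (inj₂ n) (inj₁ n′) e = contradiction e (next²-≢ n n′)
  locally-injective (inj₂ n) (inj₂ n′) _ = cycleNext-injective n n′

-- The Klein four-group, as bitwise exclusive or on two-bit colors.

infixl 6 _⊕_

_⊕_ : Fin 4 → Fin 4 → Fin 4
0F ⊕ b  = b
1F ⊕ 0F = 1F
1F ⊕ 1F = 0F
1F ⊕ 2F = 3F
1F ⊕ 3F = 2F
2F ⊕ 0F = 2F
2F ⊕ 1F = 3F
2F ⊕ 2F = 0F
2F ⊕ 3F = 1F
3F ⊕ 0F = 3F
3F ⊕ 1F = 2F
3F ⊕ 2F = 1F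
3F ⊕ 3F = 0F

⊕-cancelˡ : ∀ a b c → a ⊕ b ≡ a ⊕ c → b ≡ c
⊕-cancelˡ = from-yes
  (all? λ a → all? λ b → all? λ c → (a ⊕ b ≟ a ⊕ c) →-dec (b ≟ c))

⊕-cancelʳ : ∀ a b c → b ⊕ a ≡ c ⊕ a → b ≡ c
⊕-cancelʳ = from-yes
  (all? λ a → all? λ b → all? λ c → (b ⊕ a ≟ c ⊕ a) →-dec (b ≟ c))

-- Both equations say a ⊕ b ≡ c ⊕ d, every element being its own inverse.
⊕-exchange : ∀ a b c d → a ⊕ c ≡ b ⊕ d → a ⊕ d ≡ b ⊕ c
⊕-exchange = from-yes
  (all? λ a → all? λ b → all? λ c → all? λ d → (a ⊕ c ≟ b ⊕ d) →-dec (a ⊕ d ≟ b ⊕ c))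

-- The sum of two such colorings on a product of graphs.

module ProductColoring {G H : Graph}
  {x : Coloring G 4} (x-square : SquareColoring G x)
  {y : Coloring H 4} (y-square : SquareColoring H y) where

  private
    f : Coloring (G □ H) 4
    f (u , v) = x u ⊕ y v

    Horizontal Vertical : Vertex (G □ H) → Vertex (G □ H) → Set
    Horizontal (u , v) (u′ , v′) = Adj G u u′ × v ≡ v′
    Vertical   (u , v) (u′ , v′) = u ≡ u′ × Adj H v v′

  proper : Proper (G □ H) f
  proper {u , v} (inj₁ (refl , a)) e = proj₁ y-square a (⊕-cancelˡ (x u) _ _ e)
  proper {u , v} (inj₂ (a , refl)) e = proj₁ x-square a (⊕-cancelʳ (y v) _ _ e)

  -- The common `y v` cancels, leaving two neighbors of one vertex of `G` with equal `x`.
  horizontal² : ∀ {p q r} → Horizontal p q → Horizontal q r → f p ≡ f r → p ≡ r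
  horizontal² {u , v} (a , refl) (a′ , refl) e =
    cong (_, v) (proj₂ x-square (symm G a) a′ (⊕-cancelʳ (y v) _ _ e))

  vertical² : ∀ {p q r} → Vertical p q → Vertical q r → f p ≡ f r → p ≡ r
  vertical² {u , v} (refl , a) (refl , a′) e =
    cong (u ,_) (proj₂ y-square (symm H a) a′ (⊕-cancelˡ (x u) _ _ e))

  -- Exchange in `p~r` gives the corner (`u₀`, `v₁`) the color of `q`, hence of `s`. Cancelling
  -- `y v₁` equates the colors of `u₀` and `u₂`, both neighbors of `u₁`. The second coordinate
  -- follows likewise from `q~s` and `r~t`.
  alternating-closes : ∀ {p q r s t} →
    Horizontal p q → Vertical q r → Horizontal r s → Vertical s t →
    f p ≡ f r → f q ≡ f s → f r ≡ f t → p ≡ t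
  alternating-closes {u₀ , v₀} {u₁ , _} {_ , v₁} {u₂ , _} {_ , v₂}
    (h , refl) (refl , k) (h′ , refl) (refl , k′) p~r q~s r~t =
    cong₂ _,_ (proj₂ x-square (symm G h) h′ u₀~u₂) (proj₂ y-square (symm H k) k′ v₀~v₂)
    where
    u₀~u₂ : x u₀ ≡ x u₂
    u₀~u₂ = ⊕-cancelʳ (y v₁) _ _ (trans (⊕-exchange (x u₀) (x u₁) (y v₀) (y v₁) p~r) q~s)

    v₀~v₂ : y v₀ ≡ y v₂
    v₀~v₂ = ⊕-cancelˡ (x u₂) _ _
      (trans (sym (⊕-exchange (x u₁) (x u₂) (y v₀) (y v₁) q~s)) r~t)

  no-bicolored : (φ : Copy (path 6) (G □ H)) → ¬ Bicolored {G = G □ H} f φ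
  no-bicolored φ (a , b , ab) =
    by-directions (direction e₀) (direction e₁) (direction e₂) (direction e₃) (direction e₄)
    where
    p : Fin 6 → Vertex (G □ H)
    p = embed φ

    direction : ∀ {v w} → Adj (G □ H) v w → Horizontal v w ⊎ Vertical v w
    direction = Sum.swap

    e₀ : Adj (G □ H) (p 0F) (p 1F)
    e₀ = preserves φ (inj₁ (step refl))
    e₁ : Adj (G □ H) (p 1F) (p 2F)
    e₁ = preserves φ (inj₁ (step refl))
    e₂ : Adj (G □ H) (p 2F) (p 3F)
    e₂ = preserves φ (inj₁ (step refl))
    e₃ : Adj (G □ H) (p 3F) (p 4F)
    e₃ = preserves φ (inj₁ (step refl))
    e₄ : Adj (G □ H) (p 4F) (p 5F)
    e₄ = preserves φ (inj₁ (step refl))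

    alternate : ∀ {i j k} → Adj (G □ H) (p i) (p j) → Adj (G □ H) (p j) (p k) → f (p i) ≡ f (p k)
    alternate {i} {j} {k} e e′ = two-colors (ab i) (ab j) (ab k) (proper e) (proper e′)
      where
      two-colors : ∀ {c d e : Fin 4} → c ≡ a ⊎ c ≡ b → d ≡ a ⊎ d ≡ b → e ≡ a ⊎ e ≡ b →
                   c ≢ d → d ≢ e → c ≡ e
      two-colors (inj₁ refl) _           (inj₁ refl) _   _   = refl
      two-colors (inj₂ refl) _           (inj₂ refl) _   _   = refl
      two-colors (inj₁ refl) (inj₁ refl) _           c≢d _   = contradiction refl c≢d
      two-colors (inj₂ refl) (inj₂ refl) _           c≢d _   = contradiction refl c≢d
      two-colors _           (inj₁ refl) (inj₁ refl) _   d≢e = contradiction refl d≢e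
      two-colors _           (inj₂ refl) (inj₂ refl) _   d≢e = contradiction refl d≢e

    distinct : ∀ {i j} → i ≢ j → p i ≢ p j
    distinct i≢j = i≢j ∘ injective φ

    no-HH : ∀ {i j k} → i ≢ k → Horizontal (p i) (p j) → Horizontal (p j) (p k) → ⊥
    no-HH i≢k h h′ = distinct i≢k (horizontal² h h′ (alternate (inj₂ h) (inj₂ h′)))

    no-VV : ∀ {i j k} → i ≢ k → Vertical (p i) (p j) → Vertical (p j) (p k) → ⊥
    no-VV i≢k v v′ = distinct i≢k (vertical² v v′ (alternate (inj₁ v) (inj₁ v′)))

    no-HVHV : ∀ {i j k l m} → i ≢ m → Horizontal (p i) (p j) → Vertical (p j) (p k) →
              Horizontal (p k) (p l) → Vertical (p l) (p m) → ⊥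
    no-HVHV i≢m h v h′ v′ = distinct i≢m
      (alternating-closes h v h′ v′
        (alternate (inj₂ h) (inj₁ v)) (alternate (inj₁ v) (inj₂ h′)) (alternate (inj₂ h′) (inj₁ v′)))

    Direction : Fin 6 → Fin 6 → Set
    Direction i j = Horizontal (p i) (p j) ⊎ Vertical (p i) (p j)

    -- Without a repeated direction the five steps alternate, so the first four or the last four
    -- form the pattern HVHV. The fifth step is what allows a horizontal start in either case.
    by-directions : Direction 0F 1F → Direction 1F 2F → Direction 2F 3F →
                    Direction 3F 4F → Direction 4F 5F → ⊥
    by-directions (inj₁ h) (inj₁ h′) _ _ _ = no-HH (λ ()) h h′
    by-directions (inj₂ v) (inj₂ v′) _ _ _ = no-VV (λ ()) v v′
    by-directions _ (inj₁ h) (inj₁ h′) _ _ = no-HH (λ ()) h h′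
    by-directions _ (inj₂ v) (inj₂ v′) _ _ = no-VV (λ ()) v v′
    by-directions _ _ (inj₁ h) (inj₁ h′) _ = no-HH (λ ()) h h′
    by-directions _ _ (inj₂ v) (inj₂ v′) _ = no-VV (λ ()) v v′
    by-directions _ _ _ (inj₁ h) (inj₁ h′) = no-HH (λ ()) h h′
    by-directions _ _ _ (inj₂ v) (inj₂ v′) = no-VV (λ ()) v v′
    by-directions (inj₁ h) (inj₂ v) (inj₁ h′) (inj₂ v′) _ = no-HVHV (λ ()) h v h′ v′
    by-directions _ (inj₁ h) (inj₂ v) (inj₁ h′) (inj₂ v′) = no-HVHV (λ ()) h v h′ v′

  colorable : PathColorable 6 (G □ H) 4
  colorable = f , proper , no-bicolored

-- The P₆-chromatic number of the torus.

corollary14 : (m n : ℕ) (4≤m : 4 ≤ m) (4≤n : 4 ≤ n) → m ≢ 5 → n ≢ 5 →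
    HasPathChromaticNumber 6 (cycle m (<⇒≤ 4≤m) □ cycle n (<⇒≤ 4≤n)) 4
corollary14 m n 4≤m 4≤n m≢5 n≢5 = colorable , at-least-4
  where
  open ProductColoring (proj₂ (cycle-squareColoring (<⇒≤ 4≤m) m≢5))
                       (proj₂ (cycle-squareColoring (<⇒≤ 4≤n) n≢5))

  at-least-4 : ∀ c → PathColorable 6 (cycle m (<⇒≤ 4≤m) □ cycle n (<⇒≤ 4≤n)) c → 4 ≤ c
  at-least-4 c colored = ≮⇒≥ λ c<4 → grid-not-3-colorable
    (colorable-mono (≤⇒≤′ (s≤s⁻¹ c<4))
      (colorable-restrict
        (□-copy (path⊆cycle (<⇒≤ 4≤m) 4≤m) (path⊆cycle (<⇒≤ 4≤n) 4≤n)) colored))
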